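{- Let $n\geq 3$ and $d>n/2$. Then the number of zero-sum-free $d$-tuples in $\mathbb{Z}_n^d$ is $\alpha_n^d=\phi(n)\binom{n-1}{d}$.
   Context: $\mathbb{Z}_n$ is the ring of integers modulo $n$. A vector $(v_1,\dots,v_d)\in\mathbb{Z}_n^d$ is zero-sum-free if there is no non-empty subset of its components whose sum is $0$ in $\mathbb{Z}_n$; $\alpha_n^d$ denotes the number of such vectors. $\phi$ is Euler's totient function. -}

module Defs where

open import Data.Nat using (ℕ; zero; suc; _+_; _%_; NonZero)
open import Data.Nat.GCD using (gcd)
open import Data.Fin using (Fin; toℕ)
open import Data.Fin.Subset using (Subset; Nonempty; _∈_; inside; outside)
open import Data.Fin.Subset.Properties using (anySubset?; nonempty?)
open import Data.Vec using (Vec; []; _∷_; lookup)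
open import Data.List using (List; []; _∷_; length; filter; concatMap; map; allFin; upTo)
open import Data.Product using (∃; _×_; _,_)
open import Relation.Nullary using (¬_; Dec)
open import Relation.Nullary.Decidable using (¬?; _×-dec_)
open import Relation.Binary.PropositionalEquality using (_≡_)
import Data.Nat as ℕ

-- Elements of ℤ_n are represented by Fin n (residues 0..n-1).
-- Sum, as a natural number, of the components v_i with i ∈ S.
subsetSum : ∀ {n d} → Vec (Fin n) d → Subset d → ℕ
subsetSum []       []            = 0
subsetSum (x ∷ v)  (inside ∷ S)  = toℕ x + subsetSum v S
subsetSum (x ∷ v)  (outside ∷ S) = subsetSum v S

HasZeroSum : ∀ n {d} → .{{NonZero n}} → Vec (Fin n) d → Set
HasZeroSum n v = ∃ λ S → Nonempty S × (subsetSum v S % n ≡ 0)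

ZeroSumFree : ∀ n {d} → .{{NonZero n}} → Vec (Fin n) d → Set
ZeroSumFree n v = ¬ HasZeroSum n v

zeroSumFree? : ∀ n {d} → .{{_ : NonZero n}} → (v : Vec (Fin n) d) → Dec (ZeroSumFree n v)
zeroSumFree? n v = ¬? (anySubset? (λ S → nonempty? S ×-dec (subsetSum v S % n ℕ.≟ 0)))

allVecs : ∀ n d → List (Vec (Fin n) d)
allVecs n zero    = [] ∷ []
allVecs n (suc d) = concatMap (λ x → map (x ∷_) (allVecs n d)) (allFin n)

α : ∀ n d → .{{NonZero n}} → ℕ
α n d = length (filter (zeroSumFree? n) (allVecs n d))

φ : ℕ → ℕ
φ n = length (filter (λ k → gcd (suc k) n ℕ.≟ 1) (upTo n))

-- The core is the Savchev–Chen structure theorem: a zero-sum-free sequence of length d > n/2 in ℤ_n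
-- is of the form (x_1 g, …, x_d g) with positive integers x_i of sum < n.  It is proved by induction
-- on d under the weaker hypothesis that there are fewer than 2d subset sums, 0 included.  If deleting
-- some term loses at least two subset sums, the rest is (x_i g) by induction and its subset sums
-- are 0, g, …, Xg with X = Σ x_i ≥ d - 1; the translate of this set by the deleted term a must meet
-- it, so a = cg with 1 ≤ c ≤ X, the sign being forced by zero-sum-freeness.  Otherwise every deletion
-- loses only the total σ; then for terms a, b, moving from σ - a by b and then by a gives a = b or
-- σ = -b, and exchanging a and b, all terms are equal.
--
-- Zero-sum-freeness makes the order of g exceed X ≥ d > n/2, so g is a unit; g and x are determined
-- by the sequence, and Pascal's rule counts the positive vectors x with sum ≤ n - 1.

module Submission where

open import Defs
open import Data.Nat using (ℕ; _*_; _≤_; _<_; _∸_; NonZero)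
open import Data.Nat.Combinatorics using (_C_)
open import Relation.Binary.PropositionalEquality using (_≡_)

open import Data.Nat using (zero; suc; _+_; _%_; z≤n; s≤s; _≟_; _≤?_; >-nonZero⁻¹)
open import Data.Nat.Combinatorics using (nCk≡nC[n∸k]; nCn≡1; nCk+nC[k+1]≡[n+1]C[k+1])
open import Data.Nat.Coprimality as Coprimality using (coprime-divisor; gcd≡1⇒coprime)
open import Data.Nat.DivMod
open import Data.Nat.Divisibility
open import Data.Nat.GCD using (gcd; gcd[m,n]∣m; gcd[m,n]∣n; gcd-greatest)
open import Data.Nat.Properties hiding (_≟_; _≤?_)
open import Data.Nat.Tactic.RingSolver using (solve-∀)
open import Data.Fin as Fin using (Fin; zero; suc; toℕ; splitAt; punchIn)
open import Data.Fin.Properties as Fin using (pigeonhole; any?; toℕ<n)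
open import Data.Fin.Subset using (Subset; Nonempty; inside; outside; ⊤; ⊥; ∁)
open import Data.Fin.Subset.Properties using (anySubset?)
open import Data.Vec using (Vec; []; _∷_; here; there; lookup; map; sum; insertAt; removeAt; replicate)
open import Data.Vec.Properties using (insertAt-lookup; insertAt-punchIn; removeAt-insertAt; lookup⇒[]=; []=⇒lookup; ∷-injective; ∷-injectiveʳ)
open import Data.Vec.Relation.Unary.All using (All; []; _∷_)
open import Data.Vec.Relation.Unary.All.Properties using (lookup⁺)
open import Data.Vec.Relation.Binary.Pointwise.Inductive as Pointwise using (Pointwise; []; _∷_)
open import Data.List as List using (List; []; _∷_; _++_; length; filter; concatMap; cartesianProduct; cartesianProductWith; allFin; upTo)
import Data.List.Properties as List
open import Data.List.Membership.Propositional using (_∈_)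
open import Data.List.Membership.Propositional.Properties
open import Data.List.Membership.Propositional.Properties.WithK using (unique∧set⇒bag)
open import Data.List.Relation.Binary.BagAndSetEquality using (∼bag⇒↭)
open import Data.List.Relation.Binary.Permutation.Propositional.Properties using (↭-length)
open import Data.List.Relation.Unary.All as ListAll using ([]; _∷_)
import Data.List.Relation.Unary.All.Properties as ListAll
open import Data.List.Relation.Unary.AllPairs using ([]; _∷_)
open import Data.List.Relation.Unary.Any as Any using (here; there; index)
open import Data.List.Relation.Unary.Any.Properties using (lookup-index)
open import Data.List.Relation.Unary.Unique.Propositional using (Unique)
import Data.List.Relation.Unary.Unique.Propositional.Properties as Unique
open import Data.Product using (Σ; ∃; ∃₂; _×_; _,_; proj₁; proj₂)
open import Data.Sum using (_⊎_; inj₁; inj₂; [_,_]′)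
open import Function using (case_of_; mk⇔)
open import Relation.Nullary using (¬_; Dec; yes; no; contradiction)
open import Relation.Nullary.Decidable using (¬?; _×-dec_)
open import Relation.Binary.PropositionalEquality using (_≢_; refl; sym; trans; cong; cong₂; subst; subst₂; module ≡-Reasoning)

private variable
  k d : ℕ

-- Subset sums of vectors of natural numbers.

sumOver : Vec ℕ d → Subset d → ℕ
sumOver []       []            = 0
sumOver (x ∷ v)  (inside ∷ S)  = x + sumOver v S
sumOver (x ∷ v)  (outside ∷ S) = sumOver v S

swap-+ : ∀ a b c → a + (b + c) ≡ b + (a + c)
swap-+ = solve-∀

-- Subsets with or without position `i` are written with `insertAt`; this lemma and the next
-- translate between the subset sums of `v` and those left after deleting term `i`.
sumOver-insertAt-inside : ∀ (v : Vec ℕ (suc k)) i S →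
  sumOver v (insertAt S i inside) ≡ lookup v i + sumOver (removeAt v i) S
sumOver-insertAt-inside (x ∷ v)         zero    S             = refl
sumOver-insertAt-inside (x ∷ v@(_ ∷ _)) (suc i) (inside ∷ S)  =
  trans (cong (x +_) (sumOver-insertAt-inside v i S)) (swap-+ x (lookup v i) _)
sumOver-insertAt-inside (x ∷ v@(_ ∷ _)) (suc i) (outside ∷ S) = sumOver-insertAt-inside v i S

sumOver-insertAt-outside : ∀ (v : Vec ℕ (suc k)) i S →
  sumOver v (insertAt S i outside) ≡ sumOver (removeAt v i) S
sumOver-insertAt-outside (x ∷ v)         zero    S             = refl
sumOver-insertAt-outside (x ∷ v@(_ ∷ _)) (suc i) (inside ∷ S)  = cong (x +_) (sumOver-insertAt-outside v i S)
sumOver-insertAt-outside (x ∷ v@(_ ∷ _)) (suc i) (outside ∷ S) = sumOver-insertAt-outside v i S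

sumOver-⊤ : (v : Vec ℕ d) → sumOver v ⊤ ≡ sum v
sumOver-⊤ []      = refl
sumOver-⊤ (x ∷ v) = cong (x +_) (sumOver-⊤ v)

sumOver-⊥ : (v : Vec ℕ d) → sumOver v ⊥ ≡ 0
sumOver-⊥ []      = refl
sumOver-⊥ (x ∷ v) = sumOver-⊥ v

sumOver-∁ : (v : Vec ℕ d) (S : Subset d) → sumOver v S + sumOver v (∁ S) ≡ sum v
sumOver-∁ []      []            = refl
sumOver-∁ (x ∷ v) (inside ∷ S)  = trans (+-assoc x _ _) (cong (x +_) (sumOver-∁ v S))
sumOver-∁ (x ∷ v) (outside ∷ S) = trans (swap-+ (sumOver v S) x _) (cong (x +_) (sumOver-∁ v S))

sum-removeAt : ∀ (v : Vec ℕ (suc k)) i → sum v ≡ lookup v i + sum (removeAt v i)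
sum-removeAt (x ∷ v)         zero    = refl
sum-removeAt (x ∷ v@(_ ∷ _)) (suc i) =
  trans (cong (x +_) (sum-removeAt v i)) (swap-+ x (lookup v i) _)

sumOver-nonempty : (v : Vec ℕ d) (S : Subset d) → 1 ≤ sumOver v S → Nonempty S
sumOver-nonempty []      []            ()
sumOver-nonempty (x ∷ v) (inside ∷ S)  _ = zero , lookup⇒[]= zero (inside ∷ S) refl
sumOver-nonempty (x ∷ v) (outside ∷ S) p with i , q ← sumOver-nonempty v S p =
  suc i , lookup⇒[]= (suc i) (outside ∷ S) ([]=⇒lookup q)

insertAt-inside-nonempty : ∀ (S : Subset k) i → Nonempty (insertAt S i inside)
insertAt-inside-nonempty S i = i , lookup⇒[]= i _ (insertAt-lookup S i inside)

insertAt-nonempty : ∀ {S : Subset k} i {b} → Nonempty S → Nonempty (insertAt S i b)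
insertAt-nonempty {S = S} i {b} (j , q) =
  punchIn i j , lookup⇒[]= _ _ (trans (insertAt-punchIn S i b j) ([]=⇒lookup q))

All-insertAt : ∀ {P : ℕ → Set} {x : Vec ℕ k} i {c} → All P x → P c → All P (insertAt x i c)
All-insertAt zero    px       pc = pc ∷ px
All-insertAt (suc i) (p ∷ px) pc = p ∷ All-insertAt i px pc

Pointwise-insertAt : ∀ {R : ℕ → ℕ → Set} (v : Vec ℕ (suc k)) i {x : Vec ℕ k} {c} →
  R (lookup v i) c → Pointwise R (removeAt v i) x → Pointwise R v (insertAt x i c)
Pointwise-insertAt (_ ∷ v)         zero    r rs       = r ∷ rs
Pointwise-insertAt (_ ∷ v@(_ ∷ _)) (suc i) r (q ∷ rs) = q ∷ Pointwise-insertAt v i r rs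

length≤sum : {x : Vec ℕ d} → All (1 ≤_) x → d ≤ sum x
length≤sum []       = z≤n
length≤sum (p ∷ ps) = +-mono-≤ p (length≤sum ps)

-- Vectors whose subset sums fill an interval.

-- For such `x` the subset sums of (x_1 g, ..., x_d g) form the whole progression 0, g, ..., Xg with
-- X = `sum x`.
Complete : Vec ℕ d → Set
Complete x = ∀ m → m ≤ sum x → ∃ λ S → sumOver x S ≡ m

Complete-replicate-1 : ∀ d → Complete (replicate d 1)
Complete-replicate-1 zero    zero    _       = [] , refl
Complete-replicate-1 (suc d) zero    _       = ⊥ , sumOver-⊥ (replicate d 1)
Complete-replicate-1 (suc d) (suc m) (s≤s p) with S , q ← Complete-replicate-1 d m p =
  inside ∷ S , cong suc q

sum-insertAt : ∀ (x : Vec ℕ k) i c → sum (insertAt x i c) ≡ c + sum x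
sum-insertAt x i c = trans (sum-removeAt (insertAt x i c) i)
  (cong₂ (λ a y → a + sum y) (insertAt-lookup x i c) (removeAt-insertAt x i c))

-- Values up to `sum x` are reached without the new entry. A larger `m` exceeds `c`, and `m ∸ c` is
-- at most `sum x`, so it is reached by the old entries.
Complete-insertAt : ∀ (x : Vec ℕ k) i {c} → c ≤ sum x → Complete x → Complete (insertAt x i c)
Complete-insertAt x i {c} c≤ complete m m≤ with m ≤? sum x
... | yes m≤x with S , q ← complete m m≤x =
  insertAt S i outside ,
  trans (sumOver-insertAt-outside (insertAt x i c) i S)
    (trans (cong (λ y → sumOver y S) (removeAt-insertAt x i c)) q)
... | no m≰x with S , q ← complete (m ∸ c) (m≤n+o⇒m∸n≤o m c (subst (m ≤_) (sum-insertAt x i c) m≤)) =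
  insertAt S i inside , (begin
    sumOver (insertAt x i c) (insertAt S i inside)
      ≡⟨ sumOver-insertAt-inside (insertAt x i c) i S ⟩
    lookup (insertAt x i c) i + sumOver (removeAt (insertAt x i c) i) S
      ≡⟨ cong₂ (λ a y → a + sumOver y S) (insertAt-lookup x i c) (removeAt-insertAt x i c) ⟩
    c + sumOver x S
      ≡⟨ cong (c +_) q ⟩
    c + (m ∸ c)
      ≡⟨ m+[n∸m]≡n (≤-trans c≤ (<⇒≤ (≰⇒> m≰x))) ⟩
    m ∎)
  where open ≡-Reasoning

-- Pigeonhole for two families in a list.

list-pigeonhole : ∀ {A : Set} (L : List A) (N : ℕ) (p q : ℕ → A) →
  (∀ i → i ≤ N → p i ∈ L) → (∀ i → i ≤ N → q i ∈ L) → length L < 2 * suc N →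
  (∃₂ λ i j → i < j × j ≤ N × p i ≡ p j) ⊎ (∃₂ λ i j → i < j × j ≤ N × q i ≡ q j) ⊎
  (∃₂ λ i j → i ≤ N × j ≤ N × p i ≡ q j)
list-pigeonhole {A} L N p q p∈ q∈ len = split i j (proj₁ (proj₂ (proj₂ hole))) same
  where
  M = suc N
  member : Fin M ⊎ Fin M → Σ A (_∈ L)
  member (inj₁ i) = _ , p∈ (toℕ i) (≤-pred (toℕ<n i))
  member (inj₂ i) = _ , q∈ (toℕ i) (≤-pred (toℕ<n i))
  f : Fin (M + M) → Fin (length L)
  f i = index (proj₂ (member (splitAt M i)))
  hole = pigeonhole (subst (length L <_) (cong (M +_) (+-identityʳ M)) len) f
  i = proj₁ hole
  j = proj₁ (proj₂ hole)
  same : proj₁ (member (splitAt M i)) ≡ proj₁ (member (splitAt M j))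
  same = trans (lookup-index (proj₂ (member (splitAt M i))))
    (trans (cong (List.lookup L) (proj₂ (proj₂ (proj₂ hole))))
      (sym (lookup-index (proj₂ (member (splitAt M j))))))
  -- Positions below `M` index `p`, the others `q`. Within one block the order of positions carries
  -- over to the indices; a coincidence across blocks comes without an order.
  split : ∀ i j → i Fin.< j → proj₁ (member (splitAt M i)) ≡ proj₁ (member (splitAt M j)) → _
  split i j i<j eq with splitAt M i in eqi | splitAt M j in eqj
  ... | inj₁ a | inj₂ b = inj₂ (inj₂ (toℕ a , toℕ b , ≤-pred (toℕ<n a) , ≤-pred (toℕ<n b) , eq))
  ... | inj₂ a | inj₁ b = inj₂ (inj₂ (toℕ b , toℕ a , ≤-pred (toℕ<n b) , ≤-pred (toℕ<n a) , sym eq))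
  ... | inj₁ a | inj₁ b = inj₁ (toℕ a , toℕ b ,
    subst₂ _<_ (trans (cong toℕ (sym (Fin.splitAt⁻¹-↑ˡ eqi))) (Fin.toℕ-↑ˡ a M))
               (trans (cong toℕ (sym (Fin.splitAt⁻¹-↑ˡ eqj))) (Fin.toℕ-↑ˡ b M)) i<j ,
    ≤-pred (toℕ<n b) , eq)
  ... | inj₂ a | inj₂ b = inj₂ (inj₁ (toℕ a , toℕ b ,
    +-cancelˡ-< M _ _ (subst₂ _<_ (trans (cong toℕ (sym (Fin.splitAt⁻¹-↑ʳ eqi))) (Fin.toℕ-↑ʳ M a))
                                   (trans (cong toℕ (sym (Fin.splitAt⁻¹-↑ʳ eqj))) (Fin.toℕ-↑ʳ M b)) i<j) ,
    ≤-pred (toℕ<n b) , eq))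

remove-∈ : ∀ {L : List ℕ} {a} → a ∈ L →
  ∃ λ L′ → length L′ < length L × (∀ {b} → b ∈ L → b ≢ a → b ∈ L′)
remove-∈ {L} {a} a∈L =
  filter ≢a? L , List.filter-notAll ≢a? L (Any.map (λ a≡b b≢a → b≢a (sym a≡b)) a∈L) , ∈-filter⁺ ≢a?
  where
  ≢a? = λ b → ¬? (b ≟ a)

-- Positive vectors, and those with sum below twice the length.

lookup≤sum : (x : Vec ℕ d) (i : Fin d) → lookup x i ≤ sum x
lookup≤sum (y ∷ x) zero    = m≤m+n y (sum x)
lookup≤sum (y ∷ x) (suc i) = ≤-trans (lookup≤sum x i) (m≤n+m (sum x) y)

sumOver≤sum : (x : Vec ℕ d) (S : Subset d) → sumOver x S ≤ sum x
sumOver≤sum x S = subst (sumOver x S ≤_) (sumOver-∁ x S) (m≤m+n _ _)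

nonempty⇒1≤sumOver : ∀ {x : Vec ℕ d} → All (1 ≤_) x → ∀ S → Nonempty S → 1 ≤ sumOver x S
nonempty⇒1≤sumOver (p ∷ _)  (inside ∷ S)  _                    = ≤-trans p (m≤m+n _ _)
nonempty⇒1≤sumOver (_ ∷ ps) (outside ∷ S) (suc i , there i∈S) = nonempty⇒1≤sumOver ps S (i , i∈S)

All-removeAt : ∀ {P : ℕ → Set} {x : Vec ℕ (suc k)} i → All P x → All P (removeAt x i)
All-removeAt zero    (_ ∷ ps)         = ps
All-removeAt (suc i) (p ∷ ps@(_ ∷ _)) = p ∷ All-removeAt i ps

-- If all entries were at least 2, the sum would reach 2d.
exists-one : {x : Vec ℕ d} → All (1 ≤_) x → sum x < 2 * d → ∃ λ i → lookup x i ≡ 1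
exists-one {x = 1 ∷ _} (_ ∷ _) _ = zero , refl
exists-one {suc d} {x = suc (suc y) ∷ x} (_ ∷ ps) lt
  with i , q ← exists-one ps (≤-<-trans (m≤n+m (sum x) y) (+-cancelˡ-< 2 _ _ (subst (2 + (y + sum x) <_) (*-suc 2 d) lt)))
  = suc i , q

-- The slack c stands for c further entries equal to 1, so that entries 1 can be set aside one by one.
complete-with-slack : ∀ {x : Vec ℕ d} c → All (1 ≤_) x → sum x < 2 * d + c →
  ∀ m → m ≤ sum x + c → ∃₂ λ S r → r ≤ c × sumOver x S + r ≡ m
complete-with-slack {x = []} c [] _ m m≤ = [] , m , m≤ , refl
complete-with-slack {suc d} {1 ∷ x} c (_ ∷ ps) lt m m≤
  with complete-with-slack (suc c) ps
         (+-cancelˡ-< 1 _ _ (subst (1 + sum x <_) (double d c) lt)) m (subst (m ≤_) (sym (+-suc (sum x) c)) m≤)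
  where
  double : ∀ d c → 2 * suc d + c ≡ 1 + (2 * d + suc c)
  double = solve-∀
... | S , r , r≤ , q with r ≤? c
... | yes r≤c = outside ∷ S , r , r≤c , q
... | no  r≰c with refl ← ≤-antisym r≤ (≰⇒> r≰c) = inside ∷ S , c , ≤-refl , trans (sym (+-suc _ c)) q
complete-with-slack {suc d} {suc (suc y) ∷ x} c (_ ∷ ps) lt m m≤ = case m ≤? sum x + c of λ where
    (yes m≤x) → let S , r , r≤ , q = rest m m≤x in outside ∷ S , r , r≤ , q
    (no m≰x)  →
      let S , r , r≤ , q = rest (m ∸ (2 + y)) (m≤n+o⇒m∸n≤o m (2 + y) (subst (m ≤_) (+-assoc (2 + y) (sum x) c) m≤))
      in inside ∷ S , r , r≤ ,
         trans (+-assoc (2 + y) _ r)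
           (trans (cong (2 + y +_) q) (m+[n∸m]≡n (≤-trans (s≤s y<) (≰⇒> m≰x))))
  where
  double : ∀ d c → 2 * suc d + c ≡ 2 + (2 * d + c)
  double = solve-∀
  lt′ : y + sum x < 2 * d + c
  lt′ = +-cancelˡ-< 2 _ _ (subst (2 + (y + sum x) <_) (double d c) lt)
  rest = complete-with-slack c ps (≤-<-trans (m≤n+m (sum x) y) lt′)
  -- This makes the head 2 + y at most `m` once `m` exceeds `sum x + c`. By `lt′`, y + `sum x` is
  -- below 2d + c, and the positive entries give d ≤ `sum x`.
  y< : y < sum x + c
  y< = +-cancelʳ-< (sum x) _ _ (<-≤-trans lt′ (subst (_≤ sum x + c + sum x) (regroup d c)
         (+-mono-≤ (+-monoˡ-≤ c (length≤sum ps)) (length≤sum ps))))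
    where
    regroup : ∀ d c → d + c + d ≡ 2 * d + c
    regroup = solve-∀

short⇒complete : {x : Vec ℕ d} → All (1 ≤_) x → sum x < 2 * d → Complete x
short⇒complete {d} {x} ps lt m m≤
  with S , zero , _ , q ← complete-with-slack 0 ps (subst (sum x <_) (sym (+-identityʳ (2 * d))) lt) m
                            (subst (m ≤_) (sym (+-identityʳ (sum x))) m≤)
  = S , trans (sym (+-identityʳ _)) q

-- Congruence modulo n and zero-sum-freeness.

module Modular (n : ℕ) .{{_ : NonZero n}} where

  infix 4 _≈_ _≈?_

  _≈_ : ℕ → ℕ → Set
  a ≈ b = a % n ≡ b % n

  _≈?_ : ∀ a b → Dec (a ≈ b)
  a ≈? b = a % n ≟ b % n

  ≡⇒≈ : ∀ {a b} → a ≡ b → a ≈ b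
  ≡⇒≈ = cong (_% n)

  ≈-+ : ∀ {a b c e} → a ≈ b → c ≈ e → a + c ≈ b + e
  ≈-+ {a} {b} {c} {e} p q =
    trans (%-distribˡ-+ a c n) (trans (cong₂ (λ r s → (r + s) % n) p q) (sym (%-distribˡ-+ b e n)))

  ≈-* : ∀ {a b c e} → a ≈ b → c ≈ e → a * c ≈ b * e
  ≈-* {a} {b} {c} {e} p q =
    trans (%-distribˡ-* a c n) (trans (cong₂ (λ r s → (r * s) % n) p q) (sym (%-distribˡ-* b e n)))

  +-cancelˡ-≈ : ∀ a {b c} → a + b ≈ a + c → b ≈ c
  +-cancelˡ-≈ a {b} {c} p = trans (shift b) (trans (≈-+ {a * (n ∸ 1)} refl p) (sym (shift c)))
    where
    expand : ∀ a b m → b + a * (1 + m) ≡ a * m + (a + b)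
    expand = solve-∀
    -- `a * (n ∸ 1)` serves as the negative of `a`: added to `a + b` it gives b + a n.
    shift : ∀ b → b ≈ a * (n ∸ 1) + (a + b)
    shift b = trans (sym ([m+kn]%n≡m%n b a n))
      (≡⇒≈ (trans (cong (λ m → b + a * m) (sym (m+[n∸m]≡n (>-nonZero⁻¹ n)))) (expand a b (n ∸ 1))))

  +-cancelʳ-≈0 : ∀ a {b} → a + b ≈ a → b ≈ 0
  +-cancelʳ-≈0 a p = +-cancelˡ-≈ a (trans p (≡⇒≈ (sym (+-identityʳ a))))

  -- Terms are natural numbers rather than elements of `Fin n`, so that sums and multiples are
  -- formed in ℕ and only compared modulo `n`.
  ZeroFree : Vec ℕ d → Set
  ZeroFree v = ∀ S → Nonempty S → ¬ sumOver v S ≈ 0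

  ZeroFree-removeAt : ∀ (v : Vec ℕ (suc k)) i → ZeroFree v → ZeroFree (removeAt v i)
  ZeroFree-removeAt v i zf S ne p =
    zf (insertAt S i outside) (insertAt-nonempty i ne) (trans (≡⇒≈ (sumOver-insertAt-outside v i S)) p)

  -- Joining position `i` to `S` would give a non-empty zero sum. This is what decides signs later:
  -- the negative of a term is never a subset sum of the others.
  no-opposite : ∀ (v : Vec ℕ (suc k)) → ZeroFree v → ∀ i S → ¬ lookup v i + sumOver (removeAt v i) S ≈ 0
  no-opposite v zf i S p =
    zf (insertAt S i inside) (insertAt-inside-nonempty S i) (trans (≡⇒≈ (sumOver-insertAt-inside v i S)) p)

  term≉0 : ∀ (v : Vec ℕ (suc k)) → ZeroFree v → ∀ i → ¬ lookup v i ≈ 0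
  term≉0 v zf i p = no-opposite v zf i ⊥
    (trans (≡⇒≈ (trans (cong (lookup v i +_) (sumOver-⊥ (removeAt v i))) (+-identityʳ _))) p)

  -- Sequences of the form (x_1 g, ..., x_d g).

  Scaled : ℕ → Vec ℕ d → Vec ℕ d → Set
  Scaled g = Pointwise (λ a y → a ≈ y * g)

  sumOver-scaled : ∀ {g} {v x : Vec ℕ d} → Scaled g v x → ∀ S → sumOver v S ≈ sumOver x S * g
  sumOver-scaled []       []            = refl
  sumOver-scaled {g = g} {a ∷ _} {y ∷ x} (p ∷ ps) (inside ∷ S) =
    trans (≈-+ p (sumOver-scaled ps S)) (≡⇒≈ (sym (*-distribʳ-+ g y (sumOver x S))))
  sumOver-scaled (p ∷ ps) (outside ∷ S) = sumOver-scaled ps S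

  record Representation (v : Vec ℕ d) : Set where
    field
      g        : ℕ
      x        : Vec ℕ d
      positive : All (1 ≤_) x
      scaled   : Scaled g v x
      complete : Complete x

    attained : ∀ m → m ≤ sum x → ∃ λ S → sumOver v S ≈ m * g
    attained m m≤ with S , q ← complete m m≤ =
      S , trans (sumOver-scaled scaled S) (≡⇒≈ (cong (_* g) q))

    -- Completeness realises `m * g` by a subset whose `x`-sum is positive, hence by a non-empty
    -- one.
    multiple≉0 : ZeroFree v → ∀ m → 1 ≤ m → m ≤ sum x → ¬ m * g ≈ 0
    multiple≉0 zf m 1≤m m≤ p with S , q ← complete m m≤ =
      zf S (sumOver-nonempty x S (subst (1 ≤_) (sym q) 1≤m))
        (trans (sumOver-scaled scaled S) (trans (≡⇒≈ (cong (_* g) q)) p))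

    multiples-distinct : ZeroFree v → ∀ {i j} → i < j → j ≤ sum x → ¬ i * g ≈ j * g
    multiples-distinct zf {i} {j} i<j j≤ p =
      multiple≉0 zf (j ∸ i) (m<n⇒0<n∸m i<j) (≤-trans (m∸n≤m j i) j≤)
        (+-cancelʳ-≈0 (i * g) (trans (≡⇒≈ (trans (sym (*-distribʳ-+ g i (j ∸ i)))
          (cong (_* g) (m+[n∸m]≡n (<⇒≤ i<j))))) (sym p)))

  -- Deletions and the subset sums they lose.

  -- Removing term i loses no subset sum except the total, i.e. term i contributes exactly one new sum.
  OneTerm : Vec ℕ (suc k) → Fin (suc k) → Set
  OneTerm v i = ∀ S → sumOver v S ≈ sum v ⊎ ∃ λ S′ → sumOver (removeAt v i) S′ ≈ sumOver v S

  -- With σ the total, σ - a differs from σ, so it is attained without term `j`, and adding b gives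
  -- a subset sum again. Either this is σ and a = b, or it is attained without term `i` and a can be
  -- added too, giving σ + b.
  oneTerms⇒equal-or-opposite : ∀ (v : Vec ℕ (suc k)) → ZeroFree v → ∀ {i j} → OneTerm v i → OneTerm v j →
    lookup v i ≈ lookup v j ⊎ lookup v j + sum v ≈ 0
  oneTerms⇒equal-or-opposite v zf {i} {j} one-i one-j = step₁ (one-j (insertAt ⊤ i outside))
    where
    a = lookup v i
    b = lookup v j
    r = sum (removeAt v i)
    outside≡r : sumOver v (insertAt ⊤ i outside) ≡ r
    outside≡r = trans (sumOver-insertAt-outside v i ⊤) (sumOver-⊤ (removeAt v i))
    r+a≈σ : r + a ≈ sum v
    r+a≈σ = ≡⇒≈ (trans (+-comm r a) (sym (sum-removeAt v i)))

    -- `U` has sum σ + b, so its complement has sum -b. This is either σ, or attained without term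
    -- `j`, against zero-sum-freeness.
    step₃ : ∀ S → sumOver (removeAt v i) S ≈ b + r → a ≈ b ⊎ b + sum v ≈ 0
    step₃ S p = case one-j (∁ U) of λ where
        (inj₁ q)        → inj₂ (trans (≈-+ {b} refl (sym q)) b+c≈0)
        (inj₂ (S′ , q)) → contradiction (trans (≈-+ {b} refl q) b+c≈0) (no-opposite v zf j S′)
      where
      U = insertAt S i inside
      c = sumOver v (∁ U)
      regroup : ∀ a b r c → a + (b + r) + c ≡ (r + a) + (b + c)
      regroup = solve-∀
      b+c≈0 : b + c ≈ 0
      b+c≈0 = +-cancelʳ-≈0 (r + a) (trans (≡⇒≈ (sym (regroup a b r c)))
        (trans (≈-+ {c = c} (trans (≈-+ {a} refl (sym p)) (≡⇒≈ (sym (sumOver-insertAt-inside v i S)))) refl)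
          (trans (≡⇒≈ (sumOver-∁ v U)) (sym r+a≈σ))))

    step₂ : ∀ S → sumOver (removeAt v j) S ≈ r → a ≈ b ⊎ b + sum v ≈ 0
    step₂ S p = case one-i (insertAt S j inside) of λ where
        (inj₁ q)        → inj₁ (+-cancelˡ-≈ r (trans r+a≈σ (trans (sym q) (trans ≈b+r (≡⇒≈ (+-comm b r))))))
        (inj₂ (S′ , q)) → step₃ S′ (trans q ≈b+r)
      where
      ≈b+r : sumOver v (insertAt S j inside) ≈ b + r
      ≈b+r = trans (≡⇒≈ (sumOver-insertAt-inside v j S)) (≈-+ {b} refl p)

    step₁ : _ → a ≈ b ⊎ b + sum v ≈ 0
    step₁ (inj₁ q)       =
      contradiction (+-cancelʳ-≈0 r (trans r+a≈σ (trans (sym q) (≡⇒≈ outside≡r)))) (term≉0 v zf i)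
    step₁ (inj₂ (S , q)) = step₂ S (trans q (≡⇒≈ outside≡r))

  -- If the second alternative holds in both orders, both terms are the negative of the total and
  -- hence equal after all.
  oneTerms⇒equal : ∀ (v : Vec ℕ (suc k)) → ZeroFree v → ∀ {i j} → OneTerm v i → OneTerm v j →
    lookup v i ≈ lookup v j
  oneTerms⇒equal v zf {i} {j} one-i one-j
    with oneTerms⇒equal-or-opposite v zf {i} {j} one-i one-j | oneTerms⇒equal-or-opposite v zf {j} {i} one-j one-i
  ... | inj₁ p | _      = p
  ... | inj₂ _ | inj₁ q = sym q
  ... | inj₂ p | inj₂ q = +-cancelˡ-≈ (sum v)
    (trans (≡⇒≈ (+-comm (sum v) (lookup v i))) (trans q (trans (sym p) (≡⇒≈ (+-comm (lookup v j) (sum v))))))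

  -- The total is always lost when term i is removed, so under LosesSum at least two subset sums disappear.
  LosesSum : Vec ℕ (suc k) → Fin (suc k) → Subset (suc k) → Set
  LosesSum v i S = ¬ sumOver v S ≈ sum v × ¬ (∃ λ S′ → sumOver (removeAt v i) S′ ≈ sumOver v S)

  losesSum? : ∀ (v : Vec ℕ (suc k)) i S → Dec (LosesSum v i S)
  losesSum? v i S = ¬? (sumOver v S ≈? sum v) ×-dec ¬? (anySubset? λ S′ → sumOver (removeAt v i) S′ ≈? sumOver v S)

  ¬losesSum⇒oneTerm : ∀ (v : Vec ℕ (suc k)) i → ¬ ∃ (LosesSum v i) → OneTerm v i
  ¬losesSum⇒oneTerm v i none S
    with sumOver v S ≈? sum v | anySubset? (λ S′ → sumOver (removeAt v i) S′ ≈? sumOver v S)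
  ... | yes p | _     = inj₁ p
  ... | no _  | yes q = inj₂ q
  ... | no ¬p | no ¬q = contradiction (S , ¬p , ¬q) none

  -- Otherwise the complementary subset, which contains position `i`, would have sum zero.
  removeAt-sum≉ : ∀ (v : Vec ℕ (suc k)) → ZeroFree v → ∀ i S → ¬ sumOver (removeAt v i) S ≈ sum v
  removeAt-sum≉ v zf i S p = no-opposite v zf i (∁ S) (+-cancelʳ-≈0 s (trans (≡⇒≈ σ≡) (sym p)))
    where
    s = sumOver (removeAt v i) S
    σ≡ : s + (lookup v i + sumOver (removeAt v i) (∁ S)) ≡ sum v
    σ≡ = trans (swap-+ s (lookup v i) _)
      (trans (cong (lookup v i +_) (sumOver-∁ (removeAt v i) S)) (sym (sum-removeAt v i)))

  -- Induction for the structure theorem.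

  -- The length of `L` bounds the number of subset sums without counting distinct residues.
  Covers : List ℕ → Vec ℕ d → Set
  Covers L v = ∀ S → sumOver v S % n ∈ L

  -- The total and the sum of `S` are distinct residues in `L`, and neither is a subset sum of the
  -- remaining terms, so both can be struck out.
  Covers-removeAt : ∀ {L} (v : Vec ℕ (suc k)) → ZeroFree v → Covers L v → ∀ i {S} → LosesSum v i S →
    ∃ λ L′ → 2 + length L′ ≤ length L × Covers L′ (removeAt v i)
  Covers-removeAt {L = L} v zf cover i {S} (≉σ , unattained)
    with L₁ , len₁ , keep₁ ← remove-∈ (subst (λ s → s % n ∈ L) (sumOver-⊤ v) (cover ⊤))
    with L₂ , len₂ , keep₂ ← remove-∈ (keep₁ (cover S) ≉σ)
    = L₂ , ≤-trans (s≤s len₂) len₁ , λ S′ →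
        keep₂ (keep₁ (subst (λ s → s % n ∈ L) (sumOver-insertAt-outside v i S′) (cover (insertAt S′ i outside)))
                     (removeAt-sum≉ v zf i S′))
              (λ p → unattained (S′ , p))

  -- The progression 0, g, ..., Xg, with X = `sum x`, and its translate by a both lie in `L`, which
  -- is too short for them to be disjoint. Neither repeats a value, so l g = a + m g for some l, m,
  -- and a = (l - m) g.
  Representation-insertAt : ∀ {L} (v : Vec ℕ (suc k)) → ZeroFree v → Covers L v → length L < 2 * suc k →
    ∀ i → Representation (removeAt v i) → Representation v
  Representation-insertAt {L = L} v zf cover len i rep = case
      list-pigeonhole L (sum x) (λ m → (m * g) % n) (λ m → (a + m * g) % n) without with-a
        -- The remaining k terms have positive coefficients, so each progression has X + 1 ≥ k + 1
        -- members.
        (<-≤-trans len (*-monoʳ-≤ 2 (s≤s (length≤sum positive))))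
    of λ where
      (inj₁ (_ , _ , l<m , m≤ , p))        → contradiction p (distinct l<m m≤)
      (inj₂ (inj₁ (_ , _ , l<m , m≤ , p))) → contradiction (+-cancelˡ-≈ a p) (distinct l<m m≤)
      (inj₂ (inj₂ (l , m , l≤ , m≤ , p)))  → extend l≤ m≤ p (≤-<-connex l m)
    where
    open Representation rep
    a = lookup v i
    distinct : ∀ {l m} → l < m → m ≤ sum x → ¬ l * g ≈ m * g
    distinct = multiples-distinct (ZeroFree-removeAt v i zf)

    without : ∀ m → m ≤ sum x → (m * g) % n ∈ L
    without m m≤ with S , p ← attained m m≤ =
      subst (_∈ L) (trans (≡⇒≈ (sumOver-insertAt-outside v i S)) p) (cover (insertAt S i outside))

    with-a : ∀ m → m ≤ sum x → (a + m * g) % n ∈ L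
    with-a m m≤ with S , p ← attained m m≤ =
      subst (_∈ L) (trans (≡⇒≈ (sumOver-insertAt-inside v i S)) (≈-+ {a} refl p)) (cover (insertAt S i inside))

    difference : ∀ {l m} → l ≤ m → m * g ≡ l * g + (m ∸ l) * g
    difference {l} {m} l≤m = trans (cong (_* g) (sym (m+[n∸m]≡n l≤m))) (*-distribʳ-+ g l (m ∸ l))

    extend : ∀ {l m} → l ≤ sum x → m ≤ sum x → l * g ≈ a + m * g → l ≤ m ⊎ m < l → Representation v
    -- Here a is the negative of (m - l) g, a subset sum of the other terms; l = m is included, with
    -- the multiple 0.
    extend {l} {m} l≤ m≤ p (inj₁ l≤m) with S , q ← attained (m ∸ l) (≤-trans (m∸n≤m m l) m≤) =
      contradiction
        (trans (≈-+ {a} refl q) (+-cancelʳ-≈0 (l * g) (trans (≡⇒≈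
          (trans (swap-+ (l * g) a _) (cong (a +_) (sym (difference l≤m))))) (sym p))))
        (no-opposite v zf i S)
    extend {l} {m} l≤ m≤ p (inj₂ m<l) = record
      { g        = g
      ; x        = insertAt x i (l ∸ m)
      ; positive = All-insertAt i positive (m<n⇒0<n∸m m<l)
      ; scaled   = Pointwise-insertAt v i a≈ scaled
      ; complete = Complete-insertAt x i (≤-trans (m∸n≤m l m) l≤) complete
      }
      where
      a≈ : a ≈ (l ∸ m) * g
      a≈ = +-cancelˡ-≈ (m * g) (trans (≡⇒≈ (+-comm (m * g) a)) (trans (sym p) (≡⇒≈ (difference (<⇒≤ m<l)))))

  constant-representation : ∀ (v : Vec ℕ d) g → (∀ i → lookup v i ≈ g) → Representation v
  constant-representation {d} v g ≈g = record
    { g        = g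
    ; x        = replicate d 1
    ; positive = ones d
    ; scaled   = scaled v ≈g
    ; complete = Complete-replicate-1 d
    }
    where
    ones : ∀ d → All (1 ≤_) (replicate d 1)
    ones zero    = []
    ones (suc d) = ≤-refl ∷ ones d
    scaled : ∀ {d} (v : Vec ℕ d) → (∀ i → lookup v i ≈ g) → Scaled g v (replicate d 1)
    scaled []      _  = []
    scaled (_ ∷ v) ≈g = trans (≈g zero) (≡⇒≈ (sym (*-identityˡ g))) ∷ scaled v (λ i → ≈g (suc i))

  -- The bound survives the induction because a deletion that loses a further sum shortens the list
  -- by at least two, while 2d drops by two. For d = 0 the bound is impossible.
  savchev-chen : ∀ {L} (v : Vec ℕ d) → ZeroFree v → Covers L v → length L < 2 * d → Representation v
  savchev-chen {suc k} {L} v zf cover len with any? (λ i → anySubset? (losesSum? v i))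
  ... | no none = constant-representation v (lookup v zero) λ i →
    oneTerms⇒equal v zf (¬losesSum⇒oneTerm v i λ lost → none (i , lost))
                      (¬losesSum⇒oneTerm v zero λ lost → none (zero , lost))
  ... | yes (i , S , lost) with L′ , len′ , cover′ ← Covers-removeAt v zf cover i lost =
    Representation-insertAt v zf cover len i
      (savchev-chen (removeAt v i) (ZeroFree-removeAt v i zf) cover′
        (+-cancelˡ-< 2 _ _ (≤-<-trans len′ (subst (length L <_) (*-suc 2 k) len))))

  -- The generator is a unit; it and the coefficients are unique.

  0%n≡0 : 0 % n ≡ 0
  0%n≡0 = m<n⇒m%n≡m (>-nonZero⁻¹ n)

  ≈0⇒∣ : ∀ {a} → a ≈ 0 → n ∣ a
  ≈0⇒∣ {a} p = m%n≡0⇒n∣m a n (trans p 0%n≡0)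

  ≈⇒≡ : ∀ {a b} → a < n → b < n → a ≈ b → a ≡ b
  ≈⇒≡ a<n b<n p = trans (sym (m<n⇒m%n≡m a<n)) (trans p (m<n⇒m%n≡m b<n))

  *-cancelʳ-≈ : ∀ {g} → gcd g n ≡ 1 → ∀ {a b} → a * g ≈ b * g → a ≈ b
  *-cancelʳ-≈ {g} coprime {a} {b} p =
    [ (λ a≤b → sym (ordered a≤b (sym p))) , (λ b≤a → ordered b≤a p) ]′ (≤-total a b)
    where
    ordered : ∀ {a b} → a ≤ b → b * g ≈ a * g → b ≈ a
    ordered {a} {b} a≤b p = trans (≡⇒≈ (sym (m+[n∸m]≡n a≤b))) (%-remove-+ʳ a
      (coprime-divisor (Coprimality.sym (gcd≡1⇒coprime {g} coprime)) (subst (n ∣_) (*-comm (b ∸ a) g)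
        (≈0⇒∣ (+-cancelʳ-≈0 (a * g) (trans (≡⇒≈ (trans (sym (*-distribʳ-+ g a (b ∸ a)))
          (cong (_* g) (m+[n∸m]≡n a≤b)))) p))))))

  module _ {v : Vec ℕ d} (zf : ZeroFree v) (rep : Representation v) where
    open Representation rep

    -- Otherwise `n * g`, which vanishes modulo `n`, would be among the nonzero multiples of `g`.
    representation-sum<n : sum x < n
    representation-sum<n = ≰⇒> λ n≤ → multiple≉0 zf n (>-nonZero⁻¹ n) n≤
      (trans (≡⇒≈ (*-comm n g)) ([m+kn]%n≡m%n 0 g n))

    -- Let e be the gcd and n = q e. Then q g vanishes modulo `n`, so d ≤ `sum x` < q, and q e = n <
    -- 2d ≤ 2q forces e < 2.
    representation-coprime : n < 2 * d → gcd g n ≡ 1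
    representation-coprime n<2d with gcd[m,n]∣m g n | gcd[m,n]∣n g n
    ... | divides r g≡re | divides q n≡qe = ≤-antisym (≤-pred e<2) (n≢0⇒n>0 e≢0)
      where
      e = gcd g n
      q*g≈0 : q * g ≈ 0
      q*g≈0 = trans (≡⇒≈ (trans (cong (q *_) g≡re) (trans (regroup q r e) (cong (r *_) (sym n≡qe)))))
        ([m+kn]%n≡m%n 0 r n)
        where
        regroup : ∀ q r e → q * (r * e) ≡ r * (q * e)
        regroup = solve-∀
      n≢0 : n ≢ 0
      n≢0 = m<n⇒n≢0 (>-nonZero⁻¹ n)
      q≢0 : q ≢ 0
      q≢0 q≡0 = n≢0 (trans n≡qe (cong (_* e) q≡0))
      sum<q : sum x < q
      sum<q = ≰⇒> λ q≤ → multiple≉0 zf q (n≢0⇒n>0 q≢0) q≤ q*g≈0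
      e<2 : e < 2
      e<2 = *-cancelˡ-< q e 2 (subst₂ _<_ n≡qe (*-comm 2 q)
        (<-≤-trans n<2d (*-monoʳ-≤ 2 (≤-trans (length≤sum positive) (<⇒≤ sum<q)))))
      e≢0 : e ≢ 0
      e≢0 e≡0 = n≢0 (trans n≡qe (trans (cong (q *_) e≡0) (*-zeroʳ q)))

  -- A non-empty subset sum is m g with 1 ≤ m < n, and `g` can be cancelled modulo `n`.
  scaled⇒zeroFree : ∀ {g} {v x : Vec ℕ d} → gcd g n ≡ 1 → All (1 ≤_) x → sum x < n → Scaled g v x → ZeroFree v
  scaled⇒zeroFree {x = x} coprime pos sum<n sc S ne p =
    m<n⇒n≢0 (nonempty⇒1≤sumOver pos S ne)
      (≈⇒≡ (≤-<-trans (sumOver≤sum x S) sum<n) (>-nonZero⁻¹ n)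
        (*-cancelʳ-≈ coprime (trans (sym (sumOver-scaled sc S)) p)))

  scaled-injective : ∀ {g} {v x y : Vec ℕ d} → gcd g n ≡ 1 → sum x < n → sum y < n →
    Scaled g v x → Scaled g v y → x ≡ y
  scaled-injective cop x< y< [] [] = refl
  scaled-injective {x = a ∷ x} {b ∷ y} cop x< y< (p ∷ ps) (q ∷ qs) = cong₂ _∷_
    (≈⇒≡ (≤-<-trans (m≤m+n a _) x<) (≤-<-trans (m≤m+n b _) y<) (*-cancelʳ-≈ cop (trans (sym p) q)))
    (scaled-injective cop (≤-<-trans (m≤n+m _ a) x<) (≤-<-trans (m≤n+m _ b) y<) ps qs)

  -- If x i = 1 then g is (y i) times h.  Were y i ≥ 2, an index j with y j = 1 together with a
  -- set P of other indices would have y-sum y i, hence x-sum 1, although it has at least two elements.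
  scale-unique : ∀ {g h} {v x y : Vec ℕ d} → n < 2 * d → gcd g n ≡ 1 →
    All (1 ≤_) x → All (1 ≤_) y → sum x < n → sum y < n →
    Scaled g v x → Scaled h v y → g ≈ h
  scale-unique {suc k} {g} {h} {v} {x} {y} n<2d cop x-pos y-pos x< y< sx sy
    with i , xi≡1 ← exists-one x-pos (<-trans x< n<2d)
    with j , yj≡1 ← exists-one y-pos (<-trans y< n<2d)
    = compare (lookup y i) refl
    where
    g≈yi*h : g ≈ lookup y i * h
    g≈yi*h = trans (≡⇒≈ (sym (trans (cong (_* g) xi≡1) (*-identityˡ g))))
      (trans (sym (Pointwise.lookup sx i)) (Pointwise.lookup sy i))
    y′ = removeAt y j
    sum-y≡ : sum y ≡ 1 + sum y′
    sum-y≡ = trans (sum-removeAt y j) (cong (_+ sum y′) yj≡1)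
    -- Deleting the entry 1 lowers the sum by 1 but twice the length by 2; the two strict
    -- inequalities `sum y` < n < 2(k + 1) make up the difference.
    y′-complete : Complete y′
    y′-complete = short⇒complete (All-removeAt j y-pos)
      (+-cancelˡ-< 2 _ _ (subst₂ _<_ (cong suc sum-y≡) (*-suc 2 k) (≤-<-trans y< n<2d)))
    compare : ∀ t → lookup y i ≡ t → g ≈ h
    compare zero          yi≡t = contradiction yi≡t (m<n⇒n≢0 (lookup⁺ y-pos i))
    compare (suc zero)    yi≡t = trans g≈yi*h (≡⇒≈ (trans (cong (_* h) yi≡t) (*-identityˡ h)))
    compare (suc (suc u)) yi≡t
      with P , q ← y′-complete (suc u) (≤-pred (subst₂ _≤_ yi≡t sum-y≡ (lookup≤sum y i)))
      = contradiction sum≡1 (>⇒≢ (subst (1 <_) (sym (sumOver-insertAt-inside x j P))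
          (+-mono-≤ (lookup⁺ x-pos j)
            (nonempty⇒1≤sumOver (All-removeAt j x-pos) P (sumOver-nonempty y′ P (subst (1 ≤_) (sym q) (s≤s z≤n)))))))
      where
      U = insertAt P j inside
      yU≡yi : sumOver y U ≡ lookup y i
      yU≡yi = trans (sumOver-insertAt-inside y j P) (trans (cong₂ _+_ yj≡1 q) (sym yi≡t))
      sum≡1 : sumOver x U ≡ 1
      sum≡1 = ≈⇒≡ (≤-<-trans (sumOver≤sum x U) x<) (≤-<-trans (≤-trans (s≤s z≤n) (length≤sum x-pos)) x<)
        (*-cancelʳ-≈ cop (trans (sym (sumOver-scaled sx U)) (trans (sumOver-scaled sy U)
          (trans (≡⇒≈ (cong (_* h) yU≡yi)) (trans (sym g≈yi*h) (≡⇒≈ (sym (*-identityˡ g))))))))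

  -- Passage between natural numbers and residues in `Fin n`.

  subsetSum≡sumOver : ∀ (v : Vec (Fin n) d) S → subsetSum v S ≡ sumOver (map toℕ v) S
  subsetSum≡sumOver []      []            = refl
  subsetSum≡sumOver (a ∷ v) (inside ∷ S)  = cong (toℕ a +_) (subsetSum≡sumOver v S)
  subsetSum≡sumOver (a ∷ v) (outside ∷ S) = subsetSum≡sumOver v S

  zeroSumFree⇒zeroFree : ∀ (v : Vec (Fin n) d) → ZeroSumFree n v → ZeroFree (map toℕ v)
  zeroSumFree⇒zeroFree v zsf S ne p =
    zsf (S , ne , trans (≡⇒≈ (subsetSum≡sumOver v S)) (trans p 0%n≡0))

  zeroFree⇒zeroSumFree : ∀ (v : Vec (Fin n) d) → ZeroFree (map toℕ v) → ZeroSumFree n v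
  zeroFree⇒zeroSumFree v zf (S , ne , p) =
    zf S ne (trans (≡⇒≈ (sym (subsetSum≡sumOver v S))) (trans p (sym 0%n≡0)))

  scale : ℕ → Vec ℕ d → Vec (Fin n) d
  scale g = map (λ y → (y * g) mod n)

  scale-scaled : ∀ g (x : Vec ℕ d) → Scaled g (map toℕ (scale g x)) x
  scale-scaled g []      = []
  scale-scaled g (y ∷ x) =
    trans (≡⇒≈ (Fin.toℕ-fromℕ< (m%n<n (y * g) n))) (m%n%n≡m%n (y * g) n) ∷ scale-scaled g x

  scaled⇒scale : ∀ {g h} (v : Vec (Fin n) d) {x} → g ≈ h → Scaled g (map toℕ v) x → v ≡ scale h x
  scaled⇒scale         []      _   []                = refl
  scaled⇒scale {h = h} (a ∷ v) {y ∷ x} g≈h (p ∷ ps) = cong₂ _∷_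
    (Fin.toℕ-injective (trans (sym (m<n⇒m%n≡m (toℕ<n a)))
      (trans p (trans (≈-* {y} refl g≈h) (sym (Fin.toℕ-fromℕ< (m%n<n (y * h) n)))))))
    (scaled⇒scale v g≈h ps)

  -- The residue class of g has its representative in {1, …, n} of the form 1 + k with k < n.
  representative : ∀ g → ∃ λ k → k < n × g ≈ suc k
  representative g = (g + (n ∸ 1)) % n , m%n<n _ n , sym (trans
    (≈-+ {1} refl (m%n%n≡m%n (g + (n ∸ 1)) n))
    (trans (≡⇒≈ (trans (swap-+ 1 g (n ∸ 1)) (cong (g +_) (m+[n∸m]≡n (>-nonZero⁻¹ n))))) ([m+n]%n≡m%n g n)))

  -- A common divisor of `g` and `n` divides the shared remainder modulo `n`, hence also `h`.
  gcd-resp-≈ : ∀ {g h} → g ≈ h → gcd g n ≡ gcd h n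
  gcd-resp-≈ {g} {h} g≈h = ∣-antisym (divides-gcd g≈h) (divides-gcd (sym g≈h))
    where
    divides-gcd : ∀ {g h} → g ≈ h → gcd g n ∣ gcd h n
    divides-gcd {g} {h} g≈h = gcd-greatest
      (∣n∣m%n⇒∣m (gcd[m,n]∣n g n) (subst (gcd g n ∣_) g≈h (%-presˡ-∣ (gcd[m,n]∣m g n) (gcd[m,n]∣n g n))))
      (gcd[m,n]∣n g n)

-- Counting positive vectors of bounded sum.

incrementHead : Vec ℕ (suc d) → Vec ℕ (suc d)
incrementHead (a ∷ x) = suc a ∷ x

incrementHead-injective : {x y : Vec ℕ (suc d)} → incrementHead x ≡ incrementHead y → x ≡ y
incrementHead-injective {x = _ ∷ _} {_ ∷ _} refl = refl

-- The vectors of d positive integers with sum at most m, split according to whether the head is 1.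
compositions : (m d : ℕ) → List (Vec ℕ d)
compositions m       zero    = [] ∷ []
compositions zero    (suc d) = []
compositions (suc m) (suc d) = List.map (1 ∷_) (compositions m d) ++ List.map incrementHead (compositions m (suc d))

length-compositions : (m d : ℕ) → length (compositions m d) ≡ m C d
length-compositions m       zero    = sym (trans (nCk≡nC[n∸k] {0} {m} z≤n) (nCn≡1 m))
length-compositions zero    (suc d) = refl
length-compositions (suc m) (suc d) = begin
  length (List.map (1 ∷_) (compositions m d) ++ List.map incrementHead (compositions m (suc d)))
    ≡⟨ List.length-++ (List.map (1 ∷_) (compositions m d)) ⟩
  length (List.map (1 ∷_) (compositions m d)) + length (List.map incrementHead (compositions m (suc d)))
    ≡⟨ cong₂ _+_ (List.length-map _ (compositions m d)) (List.length-map _ (compositions m (suc d))) ⟩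
  length (compositions m d) + length (compositions m (suc d))
    ≡⟨ cong₂ _+_ (length-compositions m d) (length-compositions m (suc d)) ⟩
  m C d + m C suc d
    ≡⟨ nCk+nC[k+1]≡[n+1]C[k+1] m d ⟩
  suc m C suc d ∎
  where open ≡-Reasoning

∈-compositions⁻ : ∀ m {x : Vec ℕ d} → x ∈ compositions m d → All (1 ≤_) x × sum x ≤ m
∈-compositions⁻ {zero}  m       (here refl) = [] , z≤n
∈-compositions⁻ {suc d} (suc m) x∈ with ∈-++⁻ (List.map (1 ∷_) (compositions m d)) x∈
... | inj₁ p with y , y∈ , refl ← ∈-map⁻ (1 ∷_) p
             with pos , le ← ∈-compositions⁻ m y∈ = ≤-refl ∷ pos , s≤s le
... | inj₂ p with a ∷ y , y∈ , refl ← ∈-map⁻ incrementHead p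
             with _ ∷ pos , le ← ∈-compositions⁻ m y∈ = s≤s z≤n ∷ pos , s≤s le

∈-compositions⁺ : ∀ m {x : Vec ℕ d} → All (1 ≤_) x → sum x ≤ m → x ∈ compositions m d
∈-compositions⁺ m       {[]}              []         _        = here refl
∈-compositions⁺ (suc m) {1 ∷ x}           (_ ∷ pos)  (s≤s le) =
  ∈-++⁺ˡ (∈-map⁺ (1 ∷_) (∈-compositions⁺ m pos le))
∈-compositions⁺ (suc m) {suc (suc a) ∷ x} (_ ∷ pos)  (s≤s le) =
  ∈-++⁺ʳ _ (∈-map⁺ incrementHead (∈-compositions⁺ m {suc a ∷ x} (s≤s z≤n ∷ pos) le))

compositions-unique : ∀ m d → Unique (compositions m d)
compositions-unique m       zero    = [] ∷ []
compositions-unique zero    (suc d) = []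
compositions-unique (suc m) (suc d) = Unique.++⁺
  (Unique.map⁺ ∷-injectiveʳ (compositions-unique m d))
  (Unique.map⁺ incrementHead-injective (compositions-unique m (suc d)))
  disjoint
  where
  disjoint : ∀ {x} → ¬ (x ∈ List.map (1 ∷_) (compositions m d) × x ∈ List.map incrementHead (compositions m (suc d)))
  -- A common member has head 1, so it would come from incrementing a head 0, which positivity
  -- forbids.
  disjoint (p , q) with _ , _ , refl ← ∈-map⁻ (1 ∷_) p | zero ∷ _ , y∈ , refl ← ∈-map⁻ incrementHead q
    with () ∷ _ , _ ← ∈-compositions⁻ m y∈

-- Enumerations without repetition.

-- This turns the recursion of `allVecs` into a Cartesian product, where membership and uniqueness
-- follow from the factors.
concatMap-map : ∀ {A B C : Set} (f : A → B → C) xs ys →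
  concatMap (λ x → List.map (f x) ys) xs ≡ cartesianProductWith f xs ys
concatMap-map f []       ys = refl
concatMap-map f (x ∷ xs) ys = cong (List.map (f x) ys ++_) (concatMap-map f xs ys)

length-cartesianProduct : ∀ {A B : Set} (xs : List A) (ys : List B) →
  length (cartesianProduct xs ys) ≡ length xs * length ys
length-cartesianProduct []       ys = refl
length-cartesianProduct (x ∷ xs) ys = trans (List.length-++ (List.map (x ,_) ys))
  (cong₂ _+_ (List.length-map (x ,_) ys) (length-cartesianProduct xs ys))

∈-allVecs : ∀ {n} (v : Vec (Fin n) d) → v ∈ allVecs n d
∈-allVecs         []                = here refl
∈-allVecs {suc d} {n = n} (a ∷ v) = subst (a ∷ v ∈_) (sym (concatMap-map _∷_ (allFin n) (allVecs n d)))
  (∈-cartesianProductWith⁺ _∷_ (∈-allFin a) (∈-allVecs v))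

allVecs-unique : ∀ n d → Unique (allVecs n d)
allVecs-unique n zero    = [] ∷ []
allVecs-unique n (suc d) = subst Unique (sym (concatMap-map _∷_ (allFin n) (allVecs n d)))
  (Unique.cartesianProductWith⁺ _∷_ ∷-injective (Unique.allFin⁺ n) (allVecs-unique n d))

-- Injectivity is asked only on members of `xs`, because `image` below is shown to be injective only
-- on `pairs`.
Unique-map⁺ : ∀ {A B : Set} {f : A → B} {xs} → (∀ {x y} → x ∈ xs → y ∈ xs → f x ≡ f y → x ≡ y) →
  Unique xs → Unique (List.map f xs)
Unique-map⁺ inj []         = []
Unique-map⁺ {f = f} inj (x∉ ∷ xs!) =
  ListAll.map⁺ (ListAll.tabulate λ y∈ fx≡fy → ListAll.lookup x∉ y∈ (inj (here refl) (there y∈) fx≡fy))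
  ∷ Unique-map⁺ (λ x∈ y∈ → inj (there x∈) (there y∈)) xs!

unique-set⇒length : ∀ {A : Set} {xs ys : List A} → Unique xs → Unique ys →
  (∀ {z} → z ∈ xs → z ∈ ys) → (∀ {z} → z ∈ ys → z ∈ xs) → length xs ≡ length ys
unique-set⇒length xs! ys! ⊆ ⊇ = ↭-length (∼bag⇒↭ (unique∧set⇒bag xs! ys! (mk⇔ ⊆ ⊇)))

-- Zero-sum-free vectors as pairs of a unit and a positive vector.

theorem2p5 : (n d : ℕ) → .{{_ : NonZero n}} → 3 ≤ n → n < 2 * d →
    α n d ≡ φ n * ((n ∸ 1) C d)
theorem2p5 n d _ n<2d = begin
  α n d                                     ≡⟨ unique-set⇒length zeroSumFree! images! ⊆ ⊇ ⟩
  length (List.map image pairs)             ≡⟨ List.length-map image pairs ⟩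
  length pairs                              ≡⟨ length-cartesianProduct generators (compositions (n ∸ 1) d) ⟩
  φ n * length (compositions (n ∸ 1) d)     ≡⟨ cong (φ n *_) (length-compositions (n ∸ 1) d) ⟩
  φ n * ((n ∸ 1) C d)                       ∎
  where
  open ≡-Reasoning
  open Modular n

  coprime? : ∀ k → Dec (gcd (suc k) n ≡ 1)
  coprime? k = gcd (suc k) n ≟ 1
  -- The length of this list is `φ n` by definition; a member `k` stands for the unit k + 1.
  generators = filter coprime? (upTo n)
  pairs = cartesianProduct generators (compositions (n ∸ 1) d)
  image : ℕ × Vec ℕ d → Vec (Fin n) d
  image (k , x) = scale (suc k) x

  1+[n∸1]≡n : suc (n ∸ 1) ≡ n
  1+[n∸1]≡n = m+[n∸m]≡n (>-nonZero⁻¹ n)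

  pair⁻ : ∀ {k x} → (k , x) ∈ pairs → k < n × gcd (suc k) n ≡ 1 × All (1 ≤_) x × sum x < n
  pair⁻ {k} {x} p
    with k∈ , x∈ ← ∈-cartesianProduct⁻ generators (compositions (n ∸ 1) d) p
    with k∈′ , cop ← ∈-filter⁻ coprime? {xs = upTo n} k∈
    with pos , le ← ∈-compositions⁻ (n ∸ 1) x∈
    = ∈-upTo⁻ k∈′ , cop , pos , subst (sum x <_) 1+[n∸1]≡n (s≤s le)

  image-injective : ∀ {p q} → p ∈ pairs → q ∈ pairs → image p ≡ image q → p ≡ q
  image-injective {k , x} {l , y} p∈ q∈ eq
    with k<n , k-cop , x-pos , x< ← pair⁻ p∈
    with l<n , l-cop , y-pos , y< ← pair⁻ q∈
    with sx ← scale-scaled (suc k) x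
    with sy ← subst (λ v → Scaled (suc l) (map toℕ v) y) (sym eq) (scale-scaled (suc l) y)
    -- The 1 is cancelled first because k + 1 may equal `n`, whereas `k` and `l` are below `n`.
    with refl ← ≈⇒≡ k<n l<n (+-cancelˡ-≈ 1 (scale-unique n<2d k-cop x-pos y-pos x< y< sx sy))
    = cong (k ,_) (scaled-injective k-cop x< y< sx sy)

  zeroSumFree! : Unique (filter (zeroSumFree? n) (allVecs n d))
  zeroSumFree! = Unique.filter⁺ (zeroSumFree? n) (allVecs-unique n d)

  images! : Unique (List.map image pairs)
  images! = Unique-map⁺ image-injective
    (Unique.cartesianProduct⁺ (Unique.filter⁺ coprime? (Unique.upTo⁺ n)) (compositions-unique (n ∸ 1) d))

  ⊆ : ∀ {v} → v ∈ filter (zeroSumFree? n) (allVecs n d) → v ∈ List.map image pairs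
  ⊆ {v} v∈ = subst (_∈ List.map image pairs) (sym (scaled⇒scale v g≈1+k scaled))
    (∈-map⁺ image (∈-cartesianProduct⁺
      (∈-filter⁺ coprime? (∈-upTo⁺ k<n) (trans (sym (gcd-resp-≈ g≈1+k)) (representation-coprime zf rep n<2d)))
      (∈-compositions⁺ (n ∸ 1) positive (≤-pred (subst (sum x <_) (sym 1+[n∸1]≡n) (representation-sum<n zf rep))))))
    where
    zf : ZeroFree (map toℕ v)
    zf = zeroSumFree⇒zeroFree v (proj₂ (∈-filter⁻ (zeroSumFree? n) {xs = allVecs n d} v∈))
    rep : Representation (map toℕ v)
    -- All `n` residues serve as the covering list, so its length bound is the hypothesis n < 2d.
    rep = savchev-chen {L = upTo n} (map toℕ v) zf (λ S → ∈-upTo⁺ (m%n<n _ n))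
      (subst (_< 2 * d) (sym (List.length-upTo n)) n<2d)
    open Representation rep
    k<n = proj₁ (proj₂ (representative g))
    g≈1+k = proj₂ (proj₂ (representative g))

  ⊇ : ∀ {v} → v ∈ List.map image pairs → v ∈ filter (zeroSumFree? n) (allVecs n d)
  ⊇ v∈ with (k , x) , p∈ , refl ← ∈-map⁻ image v∈ with _ , cop , pos , x< ← pair⁻ p∈ =
    ∈-filter⁺ (zeroSumFree? n) (∈-allVecs _)
      (zeroFree⇒zeroSumFree (scale (suc k) x) (scaled⇒zeroFree cop pos x< (scale-scaled (suc k) x)))
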